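{- Every ASR-graph $G$ with $|V(G)|\geq 3$ is $\gamma$-insensitive.
   Context: $\gamma(G)$ denotes the domination number of a finite simple graph $G$. For an edge $e=uv$ of $G$, $G-e$ is the graph obtained by deleting $e$, and $G_e$ is the graph obtained by subdividing $e$: delete $e$, add a new vertex $w$ and the edges $uw$ and $wv$. A finite connected simple graph $G$ of order at least two is an ASR-graph (anti-sub-removable graph) if $\gamma(G-e)\neq\gamma(G_e)$ for every edge $e$ of $G$. A graph $G$ is $\gamma$-insensitive if $\gamma(G-e)=\gamma(G)$ for every edge $e$ of $G$. -}

module Defs where

open import Data.Empty using (⊥)
open import Data.Fin.Base using (Fin; zero; suc)
open import Data.Fin.Properties using (_≟_; any?; all?)
open import Data.Fin.Subset using (Subset; _∈_; ∣_∣; ⊤)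
open import Data.Fin.Subset.Properties using (_∈?_; ∈⊤; anySubset?)
open import Data.Nat.Base using (ℕ; zero; suc; _≤_; _<_)
open import Data.Nat.Induction using (<-rec)
open import Data.Nat.Properties using (anyUpTo?; ≮⇒≥) renaming (_≟_ to _≟ℕ_)
open import Data.Product.Base using (∃; ∃₂; _×_; _,_; proj₁; proj₂)
import Data.Product.Base as Product
open import Data.Sum.Base using (_⊎_; inj₁)
import Data.Sum.Base as Sum
open import Level using (0ℓ)
open import Relation.Binary.Construct.Closure.ReflexiveTransitive using (Star)
open import Relation.Binary.Core using (Rel)
open import Relation.Binary.Definitions using (Decidable; Irreflexive; Symmetric)
open import Relation.Binary.PropositionalEquality.Core using (_≡_; _≢_; refl)
open import Relation.Nullary.Decidable.Core using (Dec; yes; no; _×-dec_; _⊎-dec_; ¬?)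
open import Relation.Nullary.Negation.Core using (¬_)
import Relation.Unary as U

-- Finite simple graphs on the vertex set Fin n.  Decidability of adjacency
-- lets the domination number be an actual natural number.
record Graph (n : ℕ) : Set₁ where
  field
    Adj    : Rel (Fin n) 0ℓ
    irrefl : Irreflexive _≡_ Adj
    symm   : Symmetric Adj
    adj?   : Decidable Adj

open Graph public

private
  variable
    n : ℕ

-- Each edge occurs once per orientation; nothing below depends on which
-- one is chosen.
Edge : Graph n → Set
Edge G = ∃₂ λ u v → Adj G u v

Connected : Graph n → Set
Connected G = ∀ u v → Star (Adj G) u v

SamePair : (u v x y : Fin n) → Set
SamePair u v x y = (x ≡ u × y ≡ v) ⊎ (x ≡ v × y ≡ u)

samePair? : (u v x y : Fin n) → Dec (SamePair u v x y)
samePair? u v x y = (x ≟ u ×-dec y ≟ v) ⊎-dec (x ≟ v ×-dec y ≟ u)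

samePair-swap : {u v x y : Fin n} → SamePair u v x y → SamePair u v y x
samePair-swap p = Sum.swap (Sum.map Product.swap Product.swap p)

delete : (G : Graph n) → Edge G → Graph n
delete G (u , v , _) = record
  { Adj    = λ x y → Adj G x y × ¬ SamePair u v x y
  ; irrefl = λ x≡y (xy , _) → irrefl G x≡y xy
  ; symm   = λ (xy , ≢e) → symm G xy , λ ≡e → ≢e (samePair-swap ≡e)
  ; adj?   = λ x y → adj? G x y ×-dec ¬? (samePair? u v x y)
  }

-- The new vertex is zero; an old vertex x becomes suc x.
subdivide : (G : Graph n) → Edge G → Graph (suc n)
subdivide {n} G e@(u , v , _) = record
  { Adj = A ; irrefl = A-irrefl ; symm = λ {x} {y} → A-symm x y ; adj? = A? }
  where
  A : Rel (Fin (suc n)) 0ℓ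
  A zero    zero    = ⊥
  A zero    (suc y) = y ≡ u ⊎ y ≡ v
  A (suc x) zero    = x ≡ u ⊎ x ≡ v
  A (suc x) (suc y) = Adj (delete G e) x y

  A-irrefl : Irreflexive _≡_ A
  A-irrefl {zero}  refl ()
  A-irrefl {suc x} refl xx = irrefl (delete G e) refl xx

  A-symm : ∀ x y → A x y → A y x
  A-symm zero    (suc y) p = p
  A-symm (suc x) zero    p = p
  A-symm (suc x) (suc y) p = symm (delete G e) p

  A? : Decidable A
  A? zero    zero    = no λ ()
  A? zero    (suc y) = y ≟ u ⊎-dec y ≟ v
  A? (suc x) zero    = x ≟ u ⊎-dec x ≟ v
  A? (suc x) (suc y) = adj? (delete G e) x y

Dominating : Graph n → Subset n → Set
Dominating G D = ∀ v → v ∈ D ⊎ ∃ λ u → u ∈ D × Adj G u v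

dominating? : (G : Graph n) → U.Decidable (Dominating G)
dominating? G D =
  all? λ v → v ∈? D ⊎-dec any? λ u → u ∈? D ×-dec adj? G u v

HasDominatingSetOfSize : Graph n → ℕ → Set
HasDominatingSetOfSize G k = ∃ λ D → Dominating G D × ∣ D ∣ ≡ k

hasDominatingSetOfSize? : (G : Graph n) → U.Decidable (HasDominatingSetOfSize G)
hasDominatingSetOfSize? G k =
  anySubset? λ D → dominating? G D ×-dec ∣ D ∣ ≟ℕ k

IsLeast : (ℕ → Set) → ℕ → Set
IsLeast P k = P k × (∀ {j} → P j → k ≤ j)

least : {P : ℕ → Set} → U.Decidable P → ∃ P → ∃ (IsLeast P)
least {P} P? (k , Pk) = <-rec (λ k → P k → ∃ (IsLeast P)) step k Pk
  where
  step : ∀ k → (∀ {j} → j < k → P j → ∃ (IsLeast P)) → P k → ∃ (IsLeast P)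
  step k rec Pk with anyUpTo? P? k
  ... | yes (j , j<k , Pj) = rec j<k Pj
  ... | no  none           = k , Pk , λ {j} Pj → ≮⇒≥ λ j<k → none (j , j<k , Pj)

dominationNumber : (G : Graph n) → ∃ (IsLeast (HasDominatingSetOfSize G))
dominationNumber G =
  least (hasDominatingSetOfSize? G) (_ , ⊤ , (λ _ → inj₁ ∈⊤) , refl)

γ : Graph n → ℕ
γ G = proj₁ (dominationNumber G)

γ-isLeast : (G : Graph n) → IsLeast (HasDominatingSetOfSize G) (γ G)
γ-isLeast G = proj₂ (dominationNumber G)

record IsASR {n : ℕ} (G : Graph n) : Set where
  field
    order≥2   : 2 ≤ n
    connected : Connected G
    γ-differs : (e : Edge G) → γ (delete G e) ≢ γ (subdivide G e)

γ-Insensitive : Graph n → Set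
γ-Insensitive G = (e : Edge G) → γ (delete G e) ≡ γ G

{-# OPTIONS --safe #-}
-- Suppose γ(G − e) > γ(G) for e = uv.  The ASR property then forces
-- γ(G_e) = γ(G), and a minimum dominating set of G_e must contain the new
-- vertex; the rest S of it has γ(G) − 1 elements, dominates every vertex
-- other than u and v, and dominates neither u nor v in G − e.  By
-- connectedness one end of e, say u, has a neighbour x ≠ v.  As x ∉ S, the
-- edge f = ux is not used by S, so S ∪ {v} dominates G − f and S ∪ {u}
-- dominates G_f: both numbers equal γ(G), against the ASR property for f.
module Submission where

open import Defs
open import Data.Empty using (⊥-elim)
open import Data.Fin.Base using (Fin; zero; suc; punchIn; punchOut)
open import Data.Fin.Properties
  using (_≟_; punchInᵢ≢i; punchIn-injective; punchIn-punchOut)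
open import Data.Fin.Subset
  using (Subset; inside; outside; _∈_; _∉_; _⊆_; _∪_; ⁅_⁆; ∣_∣)
open import Data.Fin.Subset.Properties
  using (_∈?_; drop-there; x∈⁅x⁆; p⊆p∪q; q⊆p∪q; ∪-identityʳ)
open import Data.Nat.Base using (ℕ; suc; _≤_; _<_; z≤n; s≤s)
open import Data.Nat.Properties
  using (≤-antisym; ≤-trans; ≤-reflexive; ≤∧≢⇒<; ≤-pred; <⇒≱; ≮⇒≥; n≤1+n)
open import Data.Product.Base using (∃; _×_; _,_; proj₁; proj₂)
open import Data.Sum.Base using (_⊎_; inj₁; inj₂)
open import Data.Vec.Base using (_∷_; here; there)
open import Function.Base using (_∘_)
open import Relation.Binary.Construct.Closure.ReflexiveTransitive using (Star; ε; _◅_)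
open import Relation.Binary.PropositionalEquality
  using (_≡_; _≢_; refl; sym; trans; cong; subst)
open import Relation.Nullary.Decidable.Core using (yes; no)
open import Relation.Nullary.Negation.Core using (¬_)

private
  variable
    n : ℕ
    S T : Subset n

-- Domination of single vertices under deletion and subdivision.

Dominates : Graph n → Subset n → Fin n → Set
Dominates G D v = v ∈ D ⊎ ∃ λ u → u ∈ D × Adj G u v

γ-≤ : (G : Graph n) {D : Subset n} → Dominating G D → γ G ≤ ∣ D ∣
γ-≤ G dom = proj₂ (γ-isLeast G) (_ , dom , refl)

∣p∪⁅x⁆∣≤1+∣p∣ : (p : Subset n) (x : Fin n) → ∣ p ∪ ⁅ x ⁆ ∣ ≤ suc ∣ p ∣
∣p∪⁅x⁆∣≤1+∣p∣ (inside  ∷ p) zero    =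
  s≤s (≤-trans (≤-reflexive (cong ∣_∣ (∪-identityʳ p))) (n≤1+n ∣ p ∣))
∣p∪⁅x⁆∣≤1+∣p∣ (outside ∷ p) zero    = s≤s (≤-reflexive (cong ∣_∣ (∪-identityʳ p)))
∣p∪⁅x⁆∣≤1+∣p∣ (inside  ∷ p) (suc x) = s≤s (∣p∪⁅x⁆∣≤1+∣p∣ p x)
∣p∪⁅x⁆∣≤1+∣p∣ (outside ∷ p) (suc x) = ∣p∪⁅x⁆∣≤1+∣p∣ p x

x∈p∪⁅x⁆ : (p : Subset n) (x : Fin n) → x ∈ p ∪ ⁅ x ⁆
x∈p∪⁅x⁆ p x = q⊆p∪q p ⁅ x ⁆ (x∈⁅x⁆ x)

Dominates-⊆ : (G : Graph n) → S ⊆ T → ∀ {v} → Dominates G S v → Dominates G T v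
Dominates-⊆ G S⊆T (inj₁ v∈S)            = inj₁ (S⊆T v∈S)
Dominates-⊆ G S⊆T (inj₂ (u , u∈S , uv)) = inj₂ (u , S⊆T u∈S , uv)

Dominates-∪ : (G : Graph n) (w : Fin n) {v : Fin n} →
  Dominates G S v → Dominates G (S ∪ ⁅ w ⁆) v
Dominates-∪ G w = Dominates-⊆ G (p⊆p∪q ⁅ w ⁆)

undelete : (G : Graph n) (e : Edge G) {v : Fin n} →
  Dominates (delete G e) S v → Dominates G S v
undelete G e (inj₁ v∈S)                  = inj₁ v∈S
undelete G e (inj₂ (u , u∈S , uv , _)) = inj₂ (u , u∈S , uv)

-- A dominating neighbour survives the deletion unless the edge joining it to `y` is `e` itself;
-- then `y` is one end and the neighbour in `S` is the other.
delete-or-end : (G : Graph n) (e@(u , v , _) : Edge G) {y : Fin n} →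
  Dominates G S y → (y ≡ u × v ∈ S ⊎ y ≡ v × u ∈ S) ⊎ Dominates (delete G e) S y
delete-or-end G e (inj₁ y∈S) = inj₂ (inj₁ y∈S)
delete-or-end G (u , v , _) {y} (inj₂ (z , z∈S , zy)) with samePair? u v z y
... | yes (inj₁ (refl , refl)) = inj₁ (inj₂ (refl , z∈S))
... | yes (inj₂ (refl , refl)) = inj₁ (inj₁ (refl , z∈S))
... | no  ≢e                   = inj₂ (inj₂ (z , z∈S , zy , ≢e))

delete-avoid : (G : Graph n) (e@(u , v , _) : Edge G) → u ∉ S → v ∉ S →
  ∀ {y} → Dominates G S y → Dominates (delete G e) S y
delete-avoid G e u∉S v∉S dom with delete-or-end G e dom
... | inj₁ (inj₁ (_ , v∈S)) = ⊥-elim (v∉S v∈S)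
... | inj₁ (inj₂ (_ , u∈S)) = ⊥-elim (u∉S u∈S)
... | inj₂ dom′             = dom′

subdivide-dominates : (G : Graph n) (e : Edge G) → ∀ {b y} →
  Dominates (delete G e) S y → Dominates (subdivide G e) (b ∷ S) (suc y)
subdivide-dominates G e (inj₁ y∈S)            = inj₁ (there y∈S)
subdivide-dominates G e (inj₂ (z , z∈S , zy)) = inj₂ (suc z , there z∈S , zy)

-- Old vertices are adjacent as in G - e, so the only extra help comes from the new vertex, which
-- reaches just the two ends.
subdivide-dominates⁻¹ : (G : Graph n) (e@(u , v , _) : Edge G) → ∀ {b y} →
  Dominates (subdivide G e) (b ∷ S) (suc y) →
  (b ≡ inside × (y ≡ u ⊎ y ≡ v)) ⊎ Dominates (delete G e) S y
subdivide-dominates⁻¹ G e (inj₁ y∈)                       = inj₂ (inj₁ (drop-there y∈))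
subdivide-dominates⁻¹ G e (inj₂ (zero  , here , y≡end))    = inj₁ (refl , y≡end)
subdivide-dominates⁻¹ G e (inj₂ (suc z , z∈ , zy))         = inj₂ (inj₂ (z , drop-there z∈ , zy))

-- Domination numbers after deletion and subdivision.

γ≤γ-delete : (G : Graph n) (e : Edge G) → γ G ≤ γ (delete G e)
γ≤γ-delete G e with proj₁ (γ-isLeast (delete G e))
... | D , dom , ∣D∣≡γ = subst (γ G ≤_) ∣D∣≡γ (γ-≤ G λ y → undelete G e (dom y))

-- If the new vertex is chosen, `u` can replace it at no cost: `u` dominates itself and, along `uv`,
-- also `v`.
γ≤γ-subdivide : (G : Graph n) (e : Edge G) → γ G ≤ γ (subdivide G e)
γ≤γ-subdivide G e@(u , v , uv) with proj₁ (γ-isLeast (subdivide G e))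
... | outside ∷ D , dom , ∣D∣≡γ = subst (γ G ≤_) ∣D∣≡γ (γ-≤ G domG)
  where
  domG : Dominating G D
  domG y with subdivide-dominates⁻¹ G e (dom (suc y))
  ... | inj₂ d = undelete G e d
... | inside ∷ D , dom , ∣D∣≡γ =
  subst (γ G ≤_) ∣D∣≡γ (≤-trans (γ-≤ G domG) (∣p∪⁅x⁆∣≤1+∣p∣ D u))
  where
  domG : Dominating G (D ∪ ⁅ u ⁆)
  domG y with subdivide-dominates⁻¹ G e (dom (suc y))
  ... | inj₁ (_ , inj₁ refl) = inj₁ (x∈p∪⁅x⁆ D u)
  ... | inj₁ (_ , inj₂ refl) = inj₂ (u , x∈p∪⁅x⁆ D u , uv)
  ... | inj₂ d               = Dominates-∪ G u (undelete G e d)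

-- One extra vertex repairs the loss of `e`. If `u ∈ D`, only `v` can become undominated; if
-- `u ∉ D`, then `v` never relied on `e`, so only `u` can.
γ-delete≤1+γ : (G : Graph n) (e : Edge G) → γ (delete G e) ≤ suc (γ G)
γ-delete≤1+γ G e@(u , v , uv) with proj₁ (γ-isLeast G)
... | D , dom , ∣D∣≡γ with u ∈? D
...   | yes u∈D = ≤-trans (γ-≤ (delete G e) dom′)
    (subst (λ k → ∣ D ∪ ⁅ v ⁆ ∣ ≤ suc k) ∣D∣≡γ (∣p∪⁅x⁆∣≤1+∣p∣ D v))
  where
  dom′ : Dominating (delete G e) (D ∪ ⁅ v ⁆)
  dom′ y with delete-or-end G e (dom y)
  ... | inj₁ (inj₁ (refl , _)) = inj₁ (p⊆p∪q ⁅ v ⁆ u∈D)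
  ... | inj₁ (inj₂ (refl , _)) = inj₁ (x∈p∪⁅x⁆ D v)
  ... | inj₂ d                 = Dominates-∪ (delete G e) v d
...   | no u∉D = ≤-trans (γ-≤ (delete G e) dom′)
    (subst (λ k → ∣ D ∪ ⁅ u ⁆ ∣ ≤ suc k) ∣D∣≡γ (∣p∪⁅x⁆∣≤1+∣p∣ D u))
  where
  dom′ : Dominating (delete G e) (D ∪ ⁅ u ⁆)
  dom′ y with delete-or-end G e (dom y)
  ... | inj₁ (inj₁ (refl , _))   = inj₁ (x∈p∪⁅x⁆ D u)
  ... | inj₁ (inj₂ (_    , u∈D)) = ⊥-elim (u∉D u∈D)
  ... | inj₂ d                   = Dominates-∪ (delete G e) u d

γ-subdivide≤1+γ : (G : Graph n) (e : Edge G) → γ (subdivide G e) ≤ suc (γ G)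
γ-subdivide≤1+γ G e@(u , v , uv) with proj₁ (γ-isLeast G)
... | D , dom , ∣D∣≡γ =
  subst (λ k → γ (subdivide G e) ≤ suc k) ∣D∣≡γ (γ-≤ (subdivide G e) dom′)
  where
  dom′ : Dominating (subdivide G e) (inside ∷ D)
  dom′ zero = inj₁ here
  dom′ (suc y) with delete-or-end G e (dom y)
  ... | inj₁ (inj₁ (y≡u , _)) = inj₂ (zero , here , inj₁ y≡u)
  ... | inj₁ (inj₂ (y≡v , _)) = inj₂ (zero , here , inj₂ y≡v)
  ... | inj₂ d                = subdivide-dominates G e d

-- Here γ(G - e) is squeezed to γ(G) + 1, and the ASR property denies this value to γ(G_e).
γ-subdivide≤γ : (G : Graph n) → IsASR G → (e : Edge G) →
  γ G < γ (delete G e) → γ (subdivide G e) ≤ γ G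
γ-subdivide≤γ G asr e γ<γ-delete = ≤-pred (≤∧≢⇒< (γ-subdivide≤1+γ G e)
  λ eq → IsASR.γ-differs asr e
    (trans (≤-antisym (γ-delete≤1+γ G e) γ<γ-delete) (sym eq)))

-- Both numbers are at least γ(G). Since `S` does not use the edge f = ux, one vertex added to `S`
-- suffices in either graph, and this gives at most γ(G) vertices.
γ-delete≡γ-subdivide : (G : Graph n) {u v x : Fin n} →
  Adj G u v → (ux : Adj G u x) → x ≢ v → u ∉ S → x ∉ S → suc ∣ S ∣ ≤ γ G →
  (∀ {y} → y ≢ u → y ≢ v → Dominates G S y) →
  γ (delete G (u , x , ux)) ≡ γ (subdivide G (u , x , ux))
γ-delete≡γ-subdivide {n} {S} G {u} {v} {x} uv ux x≢v u∉S x∉S ∣S∣<γ dom = trans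
  (≤-antisym (bound v (γ-≤ G-f dom-delete)) (γ≤γ-delete G f))
  (sym (≤-antisym (bound u (γ-≤ (subdivide G f) dom-subdivide)) (γ≤γ-subdivide G f)))
  where
  f = u , x , ux
  G-f = delete G f

  bound : ∀ {k} w → k ≤ ∣ S ∪ ⁅ w ⁆ ∣ → k ≤ γ G
  bound w k≤ = ≤-trans (≤-trans k≤ (∣p∪⁅x⁆∣≤1+∣p∣ S w)) ∣S∣<γ

  u≢v : u ≢ v
  u≢v u≡v = irrefl G u≡v uv

  -- As `x ≢ v`, the edge `uv` differs from f, so whichever of `u` and `v` is added dominates the
  -- other.
  uv-kept : Adj G-f u v
  uv-kept = uv , λ where
    (inj₁ (_ , v≡x)) → x≢v (sym v≡x)
    (inj₂ (_ , v≡u)) → u≢v (sym v≡u)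

  dom-rest : ∀ {y} → y ≢ u → y ≢ v → Dominates G-f S y
  dom-rest y≢u y≢v = delete-avoid G f u∉S x∉S (dom y≢u y≢v)

  dom-delete : Dominating G-f (S ∪ ⁅ v ⁆)
  dom-delete y with y ≟ v | y ≟ u
  ... | yes refl | _        = inj₁ (x∈p∪⁅x⁆ S v)
  ... | no _     | yes refl = inj₂ (v , x∈p∪⁅x⁆ S v , symm G-f uv-kept)
  ... | no y≢v   | no y≢u   = Dominates-∪ G-f v (dom-rest y≢u y≢v)

  -- Here `u` is added rather than `v`: being an end of f, it also dominates the new vertex.
  dom-subdivide : Dominating (subdivide G f) (outside ∷ (S ∪ ⁅ u ⁆))
  dom-subdivide zero = inj₂ (suc u , there (x∈p∪⁅x⁆ S u) , inj₁ refl)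
  dom-subdivide (suc y) with y ≟ u | y ≟ v
  ... | yes refl | _        = inj₁ (there (x∈p∪⁅x⁆ S u))
  ... | no _     | yes refl = inj₂ (suc u , there (x∈p∪⁅x⁆ S u) , uv-kept)
  ... | no y≢u   | no y≢v   =
    subdivide-dominates G f (Dominates-∪ G-f u (dom-rest y≢u y≢v))

-- Finding an edge that leaves the pair of ends.

third-element : 3 ≤ n → {u v : Fin n} → u ≢ v → ∃ λ z → z ≢ u × z ≢ v
third-element (s≤s (s≤s (s≤s z≤n))) {u} {v} u≢v =
  -- `i` is the position of `v` once `u` is removed; the inner `punchIn` avoids `v`, the outer one
  -- `u`.
  punchIn u (punchIn i zero) , punchInᵢ≢i u _ , λ z≡v →
    punchInᵢ≢i i zero
      (punchIn-injective u _ _ (trans z≡v (sym (punchIn-punchOut u≢v))))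
  where i = punchOut u≢v

-- Follow the walk while it stays in {u, v}; its first step out is the required edge. The start `a`
-- is general so that the walk may move between the two ends.
exit-edge : (G : Graph n) (u v : Fin n) {a z : Fin n} → a ≡ u ⊎ a ≡ v →
  z ≢ u → z ≢ v → Star (Adj G) a z →
  ∃ λ x → x ≢ u × x ≢ v × (Adj G u x ⊎ Adj G v x)
exit-edge G u v (inj₁ refl) z≢u z≢v ε = ⊥-elim (z≢u refl)
exit-edge G u v (inj₂ refl) z≢u z≢v ε = ⊥-elim (z≢v refl)
exit-edge G u v a≡ z≢u z≢v (_◅_ {j = b} ab p) with b ≟ u | b ≟ v
... | yes b≡u | _       = exit-edge G u v (inj₁ b≡u) z≢u z≢v p
... | no _    | yes b≡v = exit-edge G u v (inj₂ b≡v) z≢u z≢v p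
... | no b≢u  | no b≢v with a≡
...   | inj₁ refl = b , b≢u , b≢v , inj₁ ab
...   | inj₂ refl = b , b≢u , b≢v , inj₂ ab

-- Refuting γ(G) < γ(G - e).

module _ {n : ℕ} (G : Graph n) {u v : Fin n} (uv : Adj G u v)
         (γ<γ-delete : γ G < γ (delete G (u , v , uv))) where

  private
    e : Edge G
    e = u , v , uv

    G-e : Graph n
    G-e = delete G e

    u≢v : u ≢ v
    u≢v u≡v = irrefl G u≡v uv

  -- Such a set would already dominate G - e, with too few vertices.
  ¬dominating-without-new : Dominating (subdivide G e) (outside ∷ S) → ¬ (∣ S ∣ ≤ γ G)
  ¬dominating-without-new {S = S} dom ∣S∣≤γ = <⇒≱ γ<γ-delete (≤-trans (γ-≤ G-e dom′) ∣S∣≤γ)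
    where
    dom′ : Dominating G-e S
    dom′ y with subdivide-dominates⁻¹ G e (dom (suc y))
    ... | inj₂ d = d

  ¬dominating-with-new : IsASR G → 3 ≤ n →
    Dominating (subdivide G e) (inside ∷ S) → ¬ (suc ∣ S ∣ ≤ γ G)
  ¬dominating-with-new {S = S} asr 3≤n dom ∣S∣<γ = contra
    (let z , z≢u , z≢v = third-element 3≤n u≢v
     in exit-edge G u v (inj₁ refl) z≢u z≢v (IsASR.connected asr u z))
    where
    dom-cases : ∀ y → (y ≡ u ⊎ y ≡ v) ⊎ Dominates G-e S y
    dom-cases y with subdivide-dominates⁻¹ G e (dom (suc y))
    ... | inj₁ (_ , y≡end) = inj₁ y≡end
    ... | inj₂ d           = inj₂ d

    dom-rest : ∀ {y} → y ≢ u → y ≢ v → Dominates G S y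
    dom-rest {y} y≢u y≢v with dom-cases y
    ... | inj₁ (inj₁ y≡u) = ⊥-elim (y≢u y≡u)
    ... | inj₁ (inj₂ y≡v) = ⊥-elim (y≢v y≡v)
    ... | inj₂ d          = undelete G e d

    -- `S` has at most γ(G) - 1 elements, so one more vertex still stays below γ(G - e).
    not-dominating : ∀ w → ¬ Dominating G-e (S ∪ ⁅ w ⁆)
    not-dominating w dom′ = <⇒≱ γ<γ-delete
      (≤-trans (≤-trans (γ-≤ G-e dom′) (∣p∪⁅x⁆∣≤1+∣p∣ S w)) ∣S∣<γ)

    -- Otherwise `v` would be the only vertex left to cover, and adding it would dominate G - e.
    u-undominated : ¬ Dominates G-e S u
    u-undominated dom-u = not-dominating v dom′
      where
      dom′ : Dominating G-e (S ∪ ⁅ v ⁆)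
      dom′ y with dom-cases y
      ... | inj₁ (inj₁ refl) = Dominates-∪ G-e v dom-u
      ... | inj₁ (inj₂ refl) = inj₁ (x∈p∪⁅x⁆ S v)
      ... | inj₂ d           = Dominates-∪ G-e v d

    v-undominated : ¬ Dominates G-e S v
    v-undominated dom-v = not-dominating u dom′
      where
      dom′ : Dominating G-e (S ∪ ⁅ u ⁆)
      dom′ y with dom-cases y
      ... | inj₁ (inj₁ refl) = inj₁ (x∈p∪⁅x⁆ S u)
      ... | inj₁ (inj₂ refl) = Dominates-∪ G-e u dom-v
      ... | inj₂ d           = Dominates-∪ G-e u d

    contra : ¬ ∃ λ x → x ≢ u × x ≢ v × (Adj G u x ⊎ Adj G v x)
    contra (x , x≢u , x≢v , inj₁ ux) = IsASR.γ-differs asr (u , x , ux)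
      (γ-delete≡γ-subdivide G uv ux x≢v (u-undominated ∘ inj₁)
        -- If `x ∈ S`, then `x` would dominate `u` even in G - e, because `x` is no end of e.
        (λ x∈S → u-undominated (inj₂ (x , x∈S , symm G ux ,
          λ { (inj₁ (x≡u , _)) → x≢u x≡u ; (inj₂ (x≡v , _)) → x≢v x≡v })))
        ∣S∣<γ dom-rest)
    -- The same argument with the two ends of e exchanged.
    contra (x , x≢u , x≢v , inj₂ vx) = IsASR.γ-differs asr (v , x , vx)
      (γ-delete≡γ-subdivide G (symm G uv) vx x≢u (v-undominated ∘ inj₁)
        (λ x∈S → v-undominated (inj₂ (x , x∈S , symm G vx ,
          λ { (inj₁ (x≡u , _)) → x≢u x≡u ; (inj₂ (x≡v , _)) → x≢v x≡v })))
        ∣S∣<γ λ y≢v y≢u → dom-rest y≢u y≢v)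

γ-delete≯γ : (G : Graph n) → IsASR G → 3 ≤ n → (e : Edge G) → ¬ (γ G < γ (delete G e))
γ-delete≯γ G asr 3≤n e@(_ , _ , uv) γ<γ-delete with proj₁ (γ-isLeast (subdivide G e))
... | outside ∷ S , dom , ∣D∣≡γ = ¬dominating-without-new G uv γ<γ-delete dom
  (≤-trans (≤-reflexive ∣D∣≡γ) (γ-subdivide≤γ G asr e γ<γ-delete))
... | inside ∷ S , dom , ∣D∣≡γ = ¬dominating-with-new G uv γ<γ-delete asr 3≤n dom
  (≤-trans (≤-reflexive ∣D∣≡γ) (γ-subdivide≤γ G asr e γ<γ-delete))

corollary17 : ∀ {n : ℕ} (G : Graph n) → IsASR G → 3 ≤ n → γ-Insensitive G
corollary17 G asr 3≤n e = ≤-antisym (≮⇒≥ (γ-delete≯γ G asr 3≤n e)) (γ≤γ-delete G e)
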